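{- If $\mathcal{C}$ is a minimal $[n,k]_{q^m/q}$ code with $k\ge2$, then $n\ge k+m-1$.
   Context: Let $q$ be a prime power and $n,m,k$ positive integers. For $v\in\mathbb{F}_{q^m}^n$ and an ordered basis $\Gamma=(\gamma_1,\dots,\gamma_m)$ of $\mathbb{F}_{q^m}$ over $\mathbb{F}_q$, let $\Gamma(v)\in\mathbb{F}_q^{n\times m}$ be the matrix with $v_i=\sum_{j}\Gamma(v)_{ij}\gamma_j$. The rank support $\sigma^{\mathrm{rk}}(v)\subseteq\mathbb{F}_q^n$ is the column space of $\Gamma(v)$ (independent of $\Gamma$). An $[n,k]_{q^m/q}$ code is a $k$-dimensional $\mathbb{F}_{q^m}$-subspace $\mathcal{C}\subseteq\mathbb{F}_{q^m}^n$. It is minimal if for all $v,v'\in\mathcal{C}$, $\sigma^{\mathrm{rk}}(v')\subseteq\sigma^{\mathrm{rk}}(v)$ implies $v'=\alpha v$ for some $\alpha\in\mathbb{F}_{q^m}$. -}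

module Defs where

open import Algebra.Apartness.Bundles using (HeytingField; HeytingCommutativeRing)
open import Algebra.Bundles using (Ring; CommutativeRing)
open import Algebra.Construct.Pointwise using (isAbelianGroup)
open import Algebra.Module.Bundles using (LeftModule)
open import Algebra.Morphism.Bundles using (RingHomomorphism)
import Algebra.Properties.Monoid.Sum as MonoidSum
open import Algebra.Structures using (IsAbelianGroup)
open import Data.Fin.Base using (Fin)
import Data.Fin.Properties as Fin
open import Data.Nat.Base using (ℕ; _≤_; _^_)
open import Data.Nat.Primality using (Prime)
open import Data.Product.Base using (Σ-syntax; ∃-syntax; _×_; proj₁)
open import Data.Unit.Base using (tt)
open import Data.Vec.Functional using (Vector)
open import Function.Bundles using (Inverse)
open import Level using (Level; _⊔_; suc)
open import Relation.Binary.PropositionalEquality.Core using (_≡_)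
open import Relation.Unary using (Pred; _∈_; _⊆_; U)

private
  variable
    r ℓr s ℓs a ℓ p c ℓ₁ ℓ₂ c′ ℓ₁′ ℓ₂′ : Level

IsPrimePower : ℕ → Set
IsPrimePower q = ∃[ p ] ∃[ e ] Prime p × 1 ≤ e × q ≡ p ^ e

------------------------------------------------------------------------
-- Linear algebra over a ring

module LinearAlgebra {R : Ring r ℓr} (M : LeftModule R a ℓ) where
  open Ring R using () renaming (Carrier to S; _≈_ to _≈ₛ_; 0# to 0ₛ)
  open LeftModule M
  open MonoidSum +ᴹ-monoid using (sum)

  linearCombination : ∀ {d} → Vector S d → Vector Carrierᴹ d → Carrierᴹ
  linearCombination x b = sum (λ i → x i *ₗ b i)

  Span : ∀ {d} → Vector Carrierᴹ d → Pred Carrierᴹ (r ⊔ ℓ)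
  Span {d} b v = Σ[ x ∈ Vector S d ] v ≈ᴹ linearCombination x b

  LinearlyIndependent : ∀ {d} → Vector Carrierᴹ d → Set (r ⊔ ℓr ⊔ ℓ)
  LinearlyIndependent b =
    ∀ x → linearCombination x b ≈ᴹ 0ᴹ → ∀ i → x i ≈ₛ 0ₛ

  record IsSubmodule (P : Pred Carrierᴹ p) : Set (r ⊔ a ⊔ ℓ ⊔ p) where
    field
      respects  : ∀ {u v} → u ≈ᴹ v → u ∈ P → v ∈ P
      0ᴹ-closed : 0ᴹ ∈ P
      +ᴹ-closed : ∀ {u v} → u ∈ P → v ∈ P → u +ᴹ v ∈ P
      *ₗ-closed : ∀ x {v} → v ∈ P → x *ₗ v ∈ P

  record IsBasisOf (P : Pred Carrierᴹ p) {d} (b : Vector Carrierᴹ d)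
                   : Set (r ⊔ ℓr ⊔ a ⊔ ℓ ⊔ p) where
    field
      members     : ∀ i → b i ∈ P
      independent : LinearlyIndependent b
      spanning    : P ⊆ Span b

  HasDimension : Pred Carrierᴹ p → ℕ → Set (r ⊔ ℓr ⊔ a ⊔ ℓ ⊔ p)
  HasDimension P d = Σ[ b ∈ Vector Carrierᴹ d ] IsBasisOf P b

-- The module Rⁿ.
_^ᴹ_ : (R : Ring c ℓ) → ℕ → LeftModule R c ℓ
R ^ᴹ n = record
  { Carrierᴹ = Vector Carrier n
  ; _≈ᴹ_ = λ u v → ∀ i → u i ≈ v i
  ; _+ᴹ_ = λ u v i → u i + v i
  ; _*ₗ_ = λ x v i → x * v i
  ; 0ᴹ = λ _ → 0#
  ; -ᴹ_ = λ v i → - v i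
  ; isLeftModule = record
    { isLeftSemimodule = record
      { +ᴹ-isCommutativeMonoid = record
        { isMonoid = G.isMonoid
        ; comm = G.comm
        }
      ; isPreleftSemimodule = record
        { *ₗ-cong = λ x≈y u≈v i → *-cong x≈y (u≈v i)
        ; *ₗ-zeroˡ = λ v i → zeroˡ (v i)
        ; *ₗ-distribʳ = λ v x y i → distribʳ (v i) x y
        ; *ₗ-identityˡ = λ v i → *-identityˡ (v i)
        ; *ₗ-assoc = λ x y v i → *-assoc x y (v i)
        ; *ₗ-zeroʳ = λ x i → zeroʳ x
        ; *ₗ-distribˡ = λ x u v i → distribˡ x (u i) (v i)
        }
      }
    ; -ᴹ‿cong = G.⁻¹-cong
    ; -ᴹ‿inverse = G.inverse
    }
  }
  where
  open Ring R
  module G = IsAbelianGroup (isAbelianGroup (Fin n) +-isAbelianGroup)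

-- S as an R-module via a ring homomorphism R → S.
restrictScalars : {R : Ring r ℓr} {S : Ring s ℓs} →
                  RingHomomorphism (Ring.rawRing R) (Ring.rawRing S) →
                  LeftModule R s ℓs
restrictScalars {R = R} {S = S} ι = record
  { Carrierᴹ = S.Carrier
  ; _≈ᴹ_ = S._≈_
  ; _+ᴹ_ = S._+_
  ; _*ₗ_ = λ x y → ⟦ x ⟧ S.* y
  ; 0ᴹ = S.0#
  ; -ᴹ_ = S.-_
  ; isLeftModule = record
    { isLeftSemimodule = record
      { +ᴹ-isCommutativeMonoid = S.+-isCommutativeMonoid
      ; isPreleftSemimodule = record
        { *ₗ-cong = λ x≈x′ y≈y′ → S.*-cong (⟦⟧-cong x≈x′) y≈y′
        ; *ₗ-zeroˡ = λ y → S.trans (S.*-congʳ 0#-homo) (S.zeroˡ y)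
        ; *ₗ-distribʳ = λ y w x →
            S.trans (S.*-congʳ (+-homo w x)) (S.distribʳ y ⟦ w ⟧ ⟦ x ⟧)
        ; *ₗ-identityˡ = λ y → S.trans (S.*-congʳ 1#-homo) (S.*-identityˡ y)
        ; *ₗ-assoc = λ w x y →
            S.trans (S.*-congʳ (*-homo w x)) (S.*-assoc ⟦ w ⟧ ⟦ x ⟧ y)
        ; *ₗ-zeroʳ = λ x → S.zeroʳ ⟦ x ⟧
        ; *ₗ-distribˡ = λ x → S.distribˡ ⟦ x ⟧
        }
      }
    ; -ᴹ‿cong = S.-‿cong
    ; -ᴹ‿inverse = S.-‿inverse
    }
  }
  where
  module S = Ring S
  open RingHomomorphism ι

------------------------------------------------------------------------
-- Finite fields

ringOf : HeytingField c ℓ₁ ℓ₂ → Ring c ℓ₁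
ringOf F = CommutativeRing.ring
  (HeytingCommutativeRing.commutativeRing (HeytingField.heytingCommutativeRing F))

-- Equality on a field of finite order is decidable, so for such fields the
-- Heyting field axioms amount to the usual ones.
HasOrder : HeytingField c ℓ₁ ℓ₂ → ℕ → Set (c ⊔ ℓ₁)
HasOrder F q = Inverse (Ring.setoid (ringOf F)) (Fin.≡-setoid q)

------------------------------------------------------------------------
-- Rank-metric codes for a field extension L / K

-- A homomorphism of fields is injective, so it exhibits K as a subfield of L.
FieldEmbedding : HeytingField c ℓ₁ ℓ₂ → HeytingField c′ ℓ₁′ ℓ₂′ →
                 Set (c ⊔ ℓ₁ ⊔ c′ ⊔ ℓ₁′)
FieldEmbedding K L =
  RingHomomorphism (Ring.rawRing (ringOf K)) (Ring.rawRing (ringOf L))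

module _ (L : HeytingField c ℓ₁ ℓ₂) where

  private
    module LA n = LinearAlgebra (ringOf L ^ᴹ n)

  record Code (n k : ℕ) (p : Level) : Set (c ⊔ ℓ₁ ⊔ suc p) where
    field
      Codeword     : Pred (Vector (HeytingField.Carrier L) n) p
      isSubspace   : LA.IsSubmodule n Codeword
      hasDimension : LA.HasDimension n Codeword k

module _ (K : HeytingField c ℓ₁ ℓ₂) (L : HeytingField c′ ℓ₁′ ℓ₂′)
         (ι : FieldEmbedding K L) where

  private
    module K = HeytingField K
    module L = HeytingField L
    module L/K = LinearAlgebra (restrictScalars {R = ringOf K} {S = ringOf L} ι)

  record OrderedBasis (m : ℕ) : Set (c ⊔ ℓ₁ ⊔ c′ ⊔ ℓ₁′) where
    field
      γ       : Vector L.Carrier m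
      isBasis : L/K.IsBasisOf U γ

  module _ {m : ℕ} (Γ : OrderedBasis m) where
    open OrderedBasis Γ

    -- Unique up to the equality of K, by independence of γ.
    coordinateMatrix : ∀ {n} → Vector L.Carrier n → Vector (Vector K.Carrier m) n
    coordinateMatrix v i = proj₁ (L/K.IsBasisOf.spanning isBasis {v i} tt)

    rankSupport : ∀ {n} → Vector L.Carrier n → Pred (Vector K.Carrier n) (c ⊔ ℓ₁)
    rankSupport {n} v =
      LinearAlgebra.Span (ringOf K ^ᴹ n) (λ j i → coordinateMatrix v i j)

    IsMinimal : ∀ {n k p} → Code L n k p → Set (c ⊔ ℓ₁ ⊔ c′ ⊔ ℓ₁′ ⊔ p)
    IsMinimal {n} C =
      ∀ {v v′} → v ∈ Codeword → v′ ∈ Codeword →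
      rankSupport v′ ⊆ rankSupport v →
      ∃[ α ] v′ ≈ᴹ α *ₗ v
      where
      open Code C
      open LeftModule (ringOf L ^ᴹ n)

{-# OPTIONS --safe #-}
module Submission where

-- If some r ≤ m entries of a codeword v are K-linearly independent and span all
-- its entries, then v = A u for the vector u of these entries and an n × r matrix
-- A over K, and every A z with z ∈ Lʳ has rank support inside that of v.  By
-- minimality the codewords A z are multiples of v, so on a hyperplane of C
-- complementary to v (any hyperplane if v = 0) only the zero word is of this form.
--
-- Start from r = 0 and enlarge r < m as follows.  If the K-linear relation between
-- the j-th entry of v and the r chosen ones fails for a codeword y, then each
-- nonzero vector of K ^ (r + 1) is a relation for at most one v + α y, so one of
-- the q ^ m choices of α gives r + 1 independent entries.  If instead all these
-- relations hold on C, then every codeword is of the form A z, which is absurd for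
-- k ≥ 2.  So r = m is reached; then (y , z) ↦ y + A z is injective from
-- (hyperplane) × Lᵐ to Lⁿ, and comparing cardinalities gives k - 1 + m ≤ n.

open import Defs
open import Algebra.Apartness.Bundles using (HeytingField; HeytingCommutativeRing)
import Algebra.Apartness.Properties.HeytingCommutativeRing as HeytingCommutativeRingProperties
open import Algebra.Bundles using (Ring; CommutativeRing; CommutativeMonoid)
open import Algebra.Module.Bundles using (LeftModule)
open import Algebra.Module.Construct.TensorUnit using (leftModule)
import Algebra.Module.Properties.LeftModule as LeftModuleProperties
import Algebra.Properties.CommutativeMonoid.Sum as CommutativeMonoidSum
import Algebra.Properties.CommutativeSemigroup as CommutativeSemigroupProperties
import Algebra.Properties.Group as GroupProperties
import Algebra.Properties.Ring as RingProperties
open import Data.Fin.Base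
  using (Fin; zero; suc; finToFun; funToFin; combine; punchIn; _↑ˡ_; _↑ʳ_; splitAt; join)
  renaming (_<_ to _<ᶠ_)
import Data.Fin.Properties as Fin
open import Data.Nat.Base
  using (ℕ; zero; suc; _+_; _∸_; _^_; _≤_; _≥_; _<_; z≤n; s≤s; NonZero; >-nonZero)
import Data.Nat.Properties as ℕ
open import Data.Product.Base using (Σ-syntax; ∃; ∃-syntax; ∃₂; _×_; _,_; proj₁; proj₂)
open import Data.Sum.Base using (_⊎_; inj₁; inj₂; swap; map₂)
open import Data.Unit.Base using (tt)
open import Data.Vec.Functional using (Vector; _∷_; insertAt)
open import Data.Vec.Functional.Properties using (insertAt-lookup; insertAt-punchIn)
open import Function.Base using (_∘_)
open import Function.Bundles using (Inverse)
open import Function.Properties.Inverse using (Inverse⇒Injection)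
open import Level using (Level; _⊔_)
open import Relation.Binary.Bundles using (Setoid)
open import Relation.Binary.PropositionalEquality as ≡ using (_≡_; _≢_)
import Relation.Binary.Reasoning.Setoid as SetoidReasoning
open import Relation.Nullary using (¬_; Dec; yes; no; contradiction)
open import Relation.Nullary.Decidable using (via-injection; toSum)
open import Relation.Unary using (U; _∈_; _⊆_)

private
  variable
    a ℓ c ℓ₁ ℓ₂ c′ ℓ₁′ ℓ₂′ p r ℓr : Level
    d N : ℕ

-- `P` and `Q` are separate predicates, so that the second alternative arrives in positive form
-- (independence, membership in a span, vanishing) instead of as a negation.
decideFin : ∀ {P : Fin N → Set p} {Q : Fin N → Set ℓ} → (∀ i → P i ⊎ Q i) → ∃ P ⊎ (∀ i → Q i)
decideFin {N = zero} f = inj₂ λ ()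
decideFin {N = suc N} f with f zero | decideFin (f ∘ suc)
... | inj₁ p₀ | _             = inj₁ (zero , p₀)
... | inj₂ q₀ | inj₁ (i , pᵢ) = inj₁ (suc i , pᵢ)
... | inj₂ q₀ | inj₂ qs       = inj₂ λ { zero → q₀ ; (suc i) → qs i }

-- Finite setoids

module _ {S : Setoid a ℓ} (|S| : Inverse S (Fin.≡-setoid N)) where
  open Setoid S
  open Inverse |S|

  finite-≈? : ∀ x y → Dec (x ≈ y)
  finite-≈? = via-injection (Inverse⇒Injection |S|) Fin._≟_

  from∘to : ∀ x → from (to x) ≈ x
  from∘to x = inverseʳ ≡.refl

  from-injective : ∀ {i j} → from i ≈ from j → i ≡ j
  from-injective fi≈fj = ≡.trans (≡.sym (inverseˡ refl)) (inverseˡ fi≈fj)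

  pigeonhole : ∀ {N′} → N < N′ → (f : Fin N′ → Carrier) →
               ∃₂ λ i j → i <ᶠ j × f i ≈ f j
  pigeonhole N<N′ f with Fin.pigeonhole N<N′ (to ∘ f)
  ... | i , j , i<j , tofi≡tofj =
    i , j , i<j , trans (sym (from∘to (f i))) (trans (from-cong tofi≡tofj) (from∘to (f j)))

  distinct⇒1< : ∀ {x y} → ¬ x ≈ y → 1 < N
  distinct⇒1< {x} {y} x≉y = helper N (to x) (to y) (x≉y ∘ to-injective)
    where
    to-injective : to x ≡ to y → x ≈ y
    to-injective eq = trans (sym (from∘to x)) (trans (from-cong eq) (from∘to y))
    helper : ∀ N → (i j : Fin N) → i ≢ j → 1 < N
    helper (suc zero)    zero zero i≢j = contradiction ≡.refl i≢j
    helper (suc (suc N)) i    j    i≢j = s≤s (s≤s z≤n)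

module _ (R : Ring r ℓr) (|R| : Inverse (Ring.setoid R) (Fin.≡-setoid N)) where
  open Inverse |R|

  -- Vectors are numbered by their base-`N` digits. This supplies the cardinalities for every
  -- pigeonhole argument and makes coefficient vectors searchable.
  finiteVectors : ∀ d → Inverse (LeftModule.≈ᴹ-setoid (R ^ᴹ d)) (Fin.≡-setoid (N ^ d))
  finiteVectors d = record
    { to        = λ x → funToFin (to ∘ x)
    ; from      = λ i → from ∘ finToFun i
    ; to-cong   = λ x≈y → funToFin-cong (λ i → to-cong (x≈y i))
    ; from-cong = λ { ≡.refl i → Ring.refl R }
    ; inverse   = (λ {i} eq → ≡.trans (funToFin-cong λ j → inverseˡ (eq j))
                                       (Fin.funToFin-finToFin {d} {N} i))
                , λ { {x} ≡.refl i → inverseʳ (Fin.finToFun-funToFin (to ∘ x) i) }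
    }
    where
    funToFin-cong : ∀ {d} {f g : Fin d → Fin N} → (∀ i → f i ≡ g i) → funToFin f ≡ funToFin g
    funToFin-cong {zero}  f≗g = ≡.refl
    funToFin-cong {suc d} f≗g = ≡.cong₂ combine (f≗g zero) (funToFin-cong (f≗g ∘ suc))

-- Linear combinations

module LinearCombination {R : Ring r ℓr} (M : LeftModule R a ℓ) where
  open Ring R using (_≈_; 0#; 1#; -_) renaming (Carrier to S; _+_ to _+ₛ_; _*_ to _*ₛ_)
  private
    module R = Ring R
    module Scalars = LinearAlgebra (leftModule {R = R})
  open LeftModule M
  open LeftModuleProperties M
  open LinearAlgebra M
  open CommutativeMonoidSum +ᴹ-commutativeMonoid using (sum-cong-≋)
  open CommutativeSemigroupProperties
    (CommutativeMonoid.commutativeSemigroup +ᴹ-commutativeMonoid) using (interchange)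
  open SetoidReasoning ≈ᴹ-setoid

  linearCombination-cong : ∀ {x y : Vector S d} {u v : Vector Carrierᴹ d} →
    (∀ i → x i ≈ y i) → (∀ i → u i ≈ᴹ v i) → linearCombination x u ≈ᴹ linearCombination y v
  linearCombination-cong x≈y u≈v = sum-cong-≋ λ i → *ₗ-cong (x≈y i) (u≈v i)

  linearCombination-zero : ∀ (b : Vector Carrierᴹ d) → linearCombination (λ _ → 0#) b ≈ᴹ 0ᴹ
  linearCombination-zero {zero}  b = ≈ᴹ-refl
  linearCombination-zero {suc d} b =
    ≈ᴹ-trans (+ᴹ-cong (*ₗ-zeroˡ (b zero)) (linearCombination-zero (b ∘ suc))) (+ᴹ-identityˡ 0ᴹ)

  -- Sum and scalar multiple are treated in one statement: `s = - 1#` gives differences, and `x = 0`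
  -- gives plain multiples. This is why later terms have the form `0# + s * y` or `x + (- 1#) * y`.
  linearCombination-linearˡ : ∀ (x : Vector S d) s y (b : Vector Carrierᴹ d) →
    linearCombination (λ i → x i +ₛ s *ₛ y i) b ≈ᴹ
    linearCombination x b +ᴹ s *ₗ linearCombination y b
  linearCombination-linearˡ {zero} x s y b =
    ≈ᴹ-sym (≈ᴹ-trans (+ᴹ-congˡ (*ₗ-zeroʳ s)) (+ᴹ-identityˡ 0ᴹ))
  linearCombination-linearˡ {suc d} x s y b = begin
    (x zero +ₛ s *ₛ y zero) *ₗ b zero +ᴹ linearCombination (λ i → x (suc i) +ₛ s *ₛ y (suc i)) (b ∘ suc)
      ≈⟨ +ᴹ-cong (≈ᴹ-trans (*ₗ-distribʳ _ _ _) (+ᴹ-congˡ (*ₗ-assoc _ _ _)))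
                 (linearCombination-linearˡ (x ∘ suc) s (y ∘ suc) (b ∘ suc)) ⟩
    (x zero *ₗ b zero +ᴹ s *ₗ y zero *ₗ b zero) +ᴹ
      (linearCombination (x ∘ suc) (b ∘ suc) +ᴹ s *ₗ linearCombination (y ∘ suc) (b ∘ suc))
      ≈⟨ interchange _ _ _ _ ⟩
    linearCombination x b +ᴹ (s *ₗ y zero *ₗ b zero +ᴹ s *ₗ linearCombination (y ∘ suc) (b ∘ suc))
      ≈⟨ +ᴹ-congˡ (*ₗ-distribˡ _ _ _) ⟨
    linearCombination x b +ᴹ s *ₗ linearCombination y b ∎

  -- Associativity of the matrix product, `x (Y b) = (x Y) b`.
  linearCombination-assoc : ∀ {e} (x : Vector S d) (y : Vector (Vector S e) d) b →
    linearCombination x (λ i → linearCombination (y i) b) ≈ᴹ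
    linearCombination (λ j → Scalars.linearCombination x (λ i → y i j)) b
  linearCombination-assoc {zero}  x y b = ≈ᴹ-sym (linearCombination-zero b)
  linearCombination-assoc {suc d} {e} x y b = begin
    x zero *ₗ linearCombination (y zero) b +ᴹ
      linearCombination (x ∘ suc) (λ i → linearCombination (y (suc i)) b)
      ≈⟨ +ᴹ-congˡ (linearCombination-assoc (x ∘ suc) (y ∘ suc) b) ⟩
    x zero *ₗ linearCombination (y zero) b +ᴹ linearCombination tails b
      ≈⟨ +ᴹ-comm _ _ ⟩
    linearCombination tails b +ᴹ x zero *ₗ linearCombination (y zero) b
      ≈⟨ linearCombination-linearˡ tails (x zero) (y zero) b ⟨
    linearCombination (λ j → tails j +ₛ x zero *ₛ y zero j) b
      ≈⟨ linearCombination-cong {e} (λ j → R.+-comm _ _) (λ _ → ≈ᴹ-refl) ⟩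
    linearCombination (λ j → Scalars.linearCombination x (λ i → y i j)) b ∎
    where
    tails = λ j → Scalars.linearCombination (x ∘ suc) (λ i → y (suc i) j)

  unitVector : Fin d → Vector S d
  unitVector zero    = 1# ∷ λ _ → 0#
  unitVector (suc i) = 0# ∷ unitVector i

  linearCombination-unit : ∀ i (b : Vector Carrierᴹ d) → linearCombination (unitVector i) b ≈ᴹ b i
  linearCombination-unit zero    b =
    ≈ᴹ-trans (+ᴹ-cong (*ₗ-identityˡ (b zero)) (linearCombination-zero (b ∘ suc))) (+ᴹ-identityʳ _)
  linearCombination-unit (suc i) b =
    ≈ᴹ-trans (+ᴹ-cong (*ₗ-zeroˡ (b zero)) (linearCombination-unit i (b ∘ suc))) (+ᴹ-identityˡ _)

  -1*ₗ : ∀ v → (- 1#) *ₗ v ≈ᴹ -ᴹ v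
  -1*ₗ v = inverseʳ-uniqueᴹ v _ (begin
    v +ᴹ (- 1#) *ₗ v           ≈⟨ +ᴹ-congʳ (*ₗ-identityˡ v) ⟨
    1# *ₗ v +ᴹ (- 1#) *ₗ v     ≈⟨ *ₗ-distribʳ v 1# (- 1#) ⟨
    (1# +ₛ - 1#) *ₗ v          ≈⟨ *ₗ-cong (R.-‿inverseʳ 1#) ≈ᴹ-refl ⟩
    0# *ₗ v                    ≈⟨ *ₗ-zeroˡ v ⟩
    0ᴹ                         ∎)

  independent⇒injective : ∀ {b : Vector Carrierᴹ d} → LinearlyIndependent b → ∀ x y →
    linearCombination x b ≈ᴹ linearCombination y b → ∀ i → x i ≈ y i
  independent⇒injective {b = b} ind x y eq i =
    GroupProperties.x∙y⁻¹≈ε⇒x≈y R.+-group _ _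
      (R.trans (R.+-congˡ (R.sym (RingProperties.-1*x≈-x R (y i)))) (ind _ difference≈0 i))
    where
    difference≈0 : linearCombination (λ i → x i +ₛ (- 1#) *ₛ y i) b ≈ᴹ 0ᴹ
    difference≈0 = begin
      linearCombination (λ i → x i +ₛ (- 1#) *ₛ y i) b               ≈⟨ linearCombination-linearˡ x (- 1#) y b ⟩
      linearCombination x b +ᴹ (- 1#) *ₗ linearCombination y b       ≈⟨ +ᴹ-cong eq (-1*ₗ _) ⟩
      linearCombination y b +ᴹ -ᴹ linearCombination y b              ≈⟨ -ᴹ‿inverseʳ _ ⟩
      0ᴹ                                                             ∎

  independent-cong : ∀ {u v : Vector Carrierᴹ d} → (∀ i → u i ≈ᴹ v i) →
    LinearlyIndependent u → LinearlyIndependent v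
  independent-cong u≈v ind x eq =
    ind x (≈ᴹ-trans (linearCombination-cong (λ _ → R.refl) u≈v) eq)

-- Finite fields and finite modules

module FiniteField (F : HeytingField c ℓ₁ ℓ₂) {s} (|F| : HasOrder F s) where
  open HeytingField F
  open HeytingCommutativeRingProperties heytingCommutativeRing using (1#0; x-0≈x)
  private
    module |F| = Inverse |F|

  infix 4 _≈?_
  _≈?_ : ∀ x y → Dec (x ≈ y)
  _≈?_ = finite-≈? |F|

  1≉0 : ¬ 1# ≈ 0#
  1≉0 1≈0 = #-irrefl 1≈0 1#0

  1<order : 1 < s
  1<order = distinct⇒1< |F| 1≉0

  -- The field axioms only refute "x is not invertible", so the inverse is
  -- found by exhaustive search.
  inverse : ∀ {x} → ¬ x ≈ 0# → ∃[ y ] y * x ≈ 1#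
  inverse {x} x≉0 with decideFin (λ i → toSum (|F|.from i * x ≈? 1#))
  ... | inj₁ (i , eq) = |F|.from i , eq
  ... | inj₂ none     = contradiction (tight⇒ λ x#0 → notInvertible (#⇒invertible x#0)) x≉0
    where
    tight⇒ : ¬ x # 0# → x ≈ 0#
    tight⇒ = proj₁ (tight x 0#)
    notInvertible : ¬ (∃[ y ] y * (x - 0#) ≈ 1# × (x - 0#) * y ≈ 1#)
    notInvertible (y , yx≈1 , _) = none (|F|.to y)
      (trans (*-cong (from∘to |F| y) (sym (x-0≈x x))) yx≈1)

module FiniteModule (F : HeytingField c ℓ₁ ℓ₂) {s} (|F| : HasOrder F s)
                    (M : LeftModule (ringOf F) a ℓ) {m}
                    -- The order `s ^ m` stands in for the dimension `m`: exchange arguments become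
                    -- counting arguments.
                    (|M| : Inverse (LeftModule.≈ᴹ-setoid M) (Fin.≡-setoid (s ^ m))) where
  private
    module F = HeytingField F
    module F^ d = Inverse (finiteVectors (ringOf F) |F| d)
    module |M| = Inverse |M|
  open FiniteField F |F|
  open LeftModule M
  open LeftModuleProperties M
  open LinearAlgebra M
  open LinearCombination M
  open SetoidReasoning ≈ᴹ-setoid

  Dependent : Vector Carrierᴹ d → Set _
  Dependent {d} b = Σ[ x ∈ Vector F.Carrier d ]
    linearCombination x b ≈ᴹ 0ᴹ × ¬ (∀ i → x i F.≈ F.0#)

  *ₗ-cancelˡ : ∀ {x u v} → ¬ x F.≈ F.0# → x *ₗ u ≈ᴹ x *ₗ v → u ≈ᴹ v
  *ₗ-cancelˡ {x} {u} {v} x≉0 xu≈xv with inverse x≉0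
  ... | y , yx≈1 = begin
    u              ≈⟨ yx*ₗ u ⟨
    y *ₗ x *ₗ u    ≈⟨ *ₗ-cong F.refl xu≈xv ⟩
    y *ₗ x *ₗ v    ≈⟨ yx*ₗ v ⟩
    v              ∎
    where
    yx*ₗ : ∀ w → y *ₗ x *ₗ w ≈ᴹ w
    yx*ₗ w = ≈ᴹ-trans (≈ᴹ-sym (*ₗ-assoc y x w))
               (≈ᴹ-trans (*ₗ-cong yx≈1 ≈ᴹ-refl) (*ₗ-identityˡ w))

  -- Exhaustive search through the `s ^ d` coefficient vectors; it makes the later case distinctions
  -- constructive.
  dependent⊎independent : (b : Vector Carrierᴹ d) → Dependent b ⊎ LinearlyIndependent b
  dependent⊎independent {d} b with decideFin decide
    where
    decide : ∀ i → let x = F^.from d i in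
      (linearCombination x b ≈ᴹ 0ᴹ × ¬ (∀ j → x j F.≈ F.0#)) ⊎
      (linearCombination x b ≈ᴹ 0ᴹ → ∀ j → x j F.≈ F.0#)
    decide i with Fin.all? (λ j → F^.from d i j ≈? F.0#)
                | finite-≈? |M| (linearCombination (F^.from d i) b) 0ᴹ
    ... | yes x≈0 | _       = inj₂ λ _ → x≈0
    ... | no  x≉0 | yes eq  = inj₁ (eq , x≉0)
    ... | no  x≉0 | no  neq = inj₂ λ eq → contradiction eq neq
  ... | inj₁ (i , dep) = inj₁ (F^.from d i , dep)
  -- The search only visits the representatives `from i`, so an arbitrary `x` is first replaced by
  -- the one equal to it.
  ... | inj₂ ind = inj₂ λ x eq j → F.trans (F.sym (x≈ x j))
        (ind (F^.to d x) (≈ᴹ-trans (linearCombination-cong (x≈ x) (λ _ → ≈ᴹ-refl)) eq) j)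
    where
    x≈ : ∀ x j → F^.from d (F^.to d x) j F.≈ x j
    x≈ = from∘to (finiteVectors (ringOf F) |F| d)

  -- The coefficient of `b zero` in the relation cannot vanish, since a relation among the tail
  -- alone is trivial. Dividing by it solves for `b zero`.
  dependent⇒span : (b : Vector Carrierᴹ (suc d)) → LinearlyIndependent (b ∘ suc) →
    Dependent b → Span (b ∘ suc) (b zero)
  dependent⇒span {d} b ind (x , eq , x≉0) with x zero ≈? F.0#
  ... | yes x₀≈0 = contradiction
        (λ { zero → x₀≈0 ; (suc i) → ind (x ∘ suc) tail≈0 i }) x≉0
    where
    tail≈0 : linearCombination (x ∘ suc) (b ∘ suc) ≈ᴹ 0ᴹ
    tail≈0 = begin
      linearCombination (x ∘ suc) (b ∘ suc)                       ≈⟨ +ᴹ-identityˡ _ ⟨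
      0ᴹ +ᴹ linearCombination (x ∘ suc) (b ∘ suc)                 ≈⟨ +ᴹ-congʳ (*ₗ-zeroˡ _) ⟨
      F.0# *ₗ b zero +ᴹ linearCombination (x ∘ suc) (b ∘ suc)     ≈⟨ +ᴹ-congʳ (*ₗ-cong x₀≈0 ≈ᴹ-refl) ⟨
      x zero *ₗ b zero +ᴹ linearCombination (x ∘ suc) (b ∘ suc)   ≈⟨ eq ⟩
      0ᴹ                                                          ∎
  ... | no  x₀≉0 with inverse x₀≉0
  ...   | y , yx₀≈1 = (λ i → F.0# F.+ (F.- y) F.* x (suc i)) , ≈ᴹ-sym (begin
    linearCombination (λ i → F.0# F.+ (F.- y) F.* x (suc i)) (b ∘ suc)
      ≈⟨ linearCombination-linearˡ (λ _ → F.0#) (F.- y) (x ∘ suc) (b ∘ suc) ⟩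
    linearCombination (λ _ → F.0#) (b ∘ suc) +ᴹ (F.- y) *ₗ rest
      ≈⟨ +ᴹ-congʳ (linearCombination-zero (b ∘ suc)) ⟩
    0ᴹ +ᴹ (F.- y) *ₗ rest
      ≈⟨ +ᴹ-identityˡ _ ⟩
    (F.- y) *ₗ rest
      ≈⟨ *ₗ-cong F.refl (inverseʳ-uniqueᴹ _ _ eq) ⟩
    (F.- y) *ₗ (-ᴹ (x zero *ₗ b zero))
      ≈⟨ *ₗ-cong F.refl (-1*ₗ _) ⟨
    (F.- y) *ₗ (F.- F.1#) *ₗ x zero *ₗ b zero
      ≈⟨ *ₗ-assoc _ _ _ ⟨
    ((F.- y) F.* (F.- F.1#)) *ₗ x zero *ₗ b zero
      ≈⟨ *ₗ-cong (F.trans (F.*-comm _ _) (F.trans (RingProperties.-1*x≈-x (ringOf F) (F.- y))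
           (RingProperties.-‿involutive (ringOf F) y))) ≈ᴹ-refl ⟩
    y *ₗ x zero *ₗ b zero
      ≈⟨ *ₗ-assoc _ _ _ ⟨
    (y F.* x zero) *ₗ b zero
      ≈⟨ *ₗ-cong yx₀≈1 ≈ᴹ-refl ⟩
    F.1# *ₗ b zero
      ≈⟨ *ₗ-identityˡ _ ⟩
    b zero ∎)
    where
    rest = linearCombination (x ∘ suc) (b ∘ suc)

  -- If `v ∷ b` were independent, its `s ^ (d + 1)` combinations would be distinct elements of a
  -- module with only `s ^ m` of them.
  independent⇒span : (b : Vector Carrierᴹ d) → LinearlyIndependent b → m ≤ d →
    ∀ v → Span b v
  independent⇒span {d} b ind m≤d v with dependent⊎independent (v ∷ b)
  ... | inj₁ dep  = dependent⇒span (v ∷ b) ind dep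
  ... | inj₂ ind′
    with pigeonhole |M| (ℕ.^-monoʳ-< s 1<order (s≤s m≤d))
           (λ i → linearCombination (F^.from (suc d) i) (v ∷ b))
  ...   | i , j , i<j , eq = contradiction
          (from-injective (finiteVectors (ringOf F) |F| (suc d))
            (independent⇒injective {b = v ∷ b} ind′ (F^.from (suc d) i) (F^.from (suc d) j) eq))
          (Fin.<⇒≢ i<j)

  -- If every element lay in the span of `b`, its coefficients would determine it, and `s ^ m`
  -- elements would inject into `s ^ d` vectors.
  independent-extend : (b : Vector Carrierᴹ d) → LinearlyIndependent b → d < m →
    ∃[ v ] LinearlyIndependent (v ∷ b)
  independent-extend {d} b ind d<m
    with decideFin (λ i → map₂ (dependent⇒span (|M|.from i ∷ b) ind)
                                (swap (dependent⊎independent (|M|.from i ∷ b))))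
  ... | inj₁ (i , ind′) = |M|.from i , ind′
  ... | inj₂ spans
    with pigeonhole (finiteVectors (ringOf F) |F| d) (ℕ.^-monoʳ-< s 1<order d<m) (proj₁ ∘ spans)
  ...   | i , j , i<j , eq = contradiction (from-injective |M| (begin
      |M|.from i                                ≈⟨ proj₂ (spans i) ⟩
      linearCombination (proj₁ (spans i)) b     ≈⟨ linearCombination-cong eq (λ _ → ≈ᴹ-refl) ⟩
      linearCombination (proj₁ (spans j)) b     ≈⟨ proj₂ (spans j) ⟨
      |M|.from j                                ∎)) (Fin.<⇒≢ i<j)

  -- Linear functionals with prescribed values

  private
    module Scalars where
      open LinearAlgebra (leftModule {R = ringOf F}) public
      open LinearCombination (leftModule {R = ringOf F}) public

  -- Taking any `v` equal to the combination lets `linear` express additivity, homogeneity and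
  -- compatibility with equality at once.
  record Functional (b : Vector Carrierᴹ d) (h : Vector F.Carrier d) : Set (c ⊔ ℓ₁ ⊔ a ⊔ ℓ) where
    field
      φ      : Carrierᴹ → F.Carrier
      linear : ∀ {e v} (x : Vector F.Carrier e) u → v ≈ᴹ linearCombination x u →
               φ v F.≈ Scalars.linearCombination x (φ ∘ u)
      values : ∀ {v} (x : Vector F.Carrier d) → v ≈ᴹ linearCombination x b →
               φ v F.≈ Scalars.linearCombination x h

  -- Independence makes the coordinates supplied by `spanning` unique, so `φ` does not depend on the
  -- choice made there.
  basisFunctional : {b : Vector Carrierᴹ d} → IsBasisOf U b → (h : Vector F.Carrier d) → Functional b h
  basisFunctional {d} {b} basis h = record { φ = φ ; linear = linear ; values = values }
    where
    open IsBasisOf basis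
    coords : Carrierᴹ → Vector F.Carrier d
    coords v = proj₁ (spanning {v} tt)
    v≈coords : ∀ v → v ≈ᴹ linearCombination (coords v) b
    v≈coords v = proj₂ (spanning {v} tt)
    φ : Carrierᴹ → F.Carrier
    φ v = Scalars.linearCombination (coords v) h
    values : ∀ {v} (x : Vector F.Carrier d) → v ≈ᴹ linearCombination x b →
             φ v F.≈ Scalars.linearCombination x h
    values {v} x v≈ = Scalars.linearCombination-cong
      (independent⇒injective independent (coords v) x (≈ᴹ-trans (≈ᴹ-sym (v≈coords v)) v≈))
      (λ _ → F.refl)
    linear : ∀ {e v} (x : Vector F.Carrier e) u → v ≈ᴹ linearCombination x u →
             φ v F.≈ Scalars.linearCombination x (φ ∘ u)
    linear {e} {v} x u v≈ = F.trans
      (values (λ j → Scalars.linearCombination x (λ i → coords (u i) j)) (begin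
        v                                                            ≈⟨ v≈ ⟩
        linearCombination x u                                        ≈⟨ linearCombination-cong (λ _ → F.refl) (v≈coords ∘ u) ⟩
        linearCombination x (λ i → linearCombination (coords (u i)) b) ≈⟨ linearCombination-assoc x (coords ∘ u) b ⟩
        linearCombination _ b                                        ∎))
      (F.sym (Scalars.linearCombination-assoc x (coords ∘ u) h))

  -- The family is completed to a basis one vector at a time, with value zero on each of the `m ∸ d`
  -- new vectors.
  independentFunctional : {b : Vector Carrierᴹ d} → LinearlyIndependent b → d ≤ m →
    (h : Vector F.Carrier d) → Functional b h
  independentFunctional {d} ind d≤m h = extend (m ∸ d) (ℕ.m∸n+n≡m d≤m) ind h
    where
    extend : ∀ e {d} {b : Vector Carrierᴹ d} → e + d ≡ m → LinearlyIndependent b →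
             (h : Vector F.Carrier d) → Functional b h
    extend zero {b = b} ≡.refl ind h = basisFunctional (record
      { members     = λ _ → tt
      ; independent = ind
      ; spanning    = λ {v} _ → independent⇒span b ind ℕ.≤-refl v
      }) h
    extend (suc e) {d} {b} e+d≡m ind h
      with independent-extend b ind (ℕ.≤-trans (s≤s (ℕ.m≤n+m d e)) (ℕ.≤-reflexive e+d≡m))
    ... | v , ind′ = record
      { φ      = φ
      ; linear = linear
      ; values = λ {w} x w≈ → F.trans
          (values (F.0# ∷ x) (≈ᴹ-trans w≈
            (≈ᴹ-sym (≈ᴹ-trans (+ᴹ-congʳ (*ₗ-zeroˡ v)) (+ᴹ-identityˡ _)))))
          (F.trans (F.+-congʳ (F.zeroˡ _)) (F.+-identityˡ _))
      }
      where
      open Functional (extend e {b = v ∷ b} (≡.trans (ℕ.+-suc e d) e+d≡m) ind′ (F.0# ∷ h))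

module _ (R : Ring r ℓr) where
  open Ring R hiding (zero) renaming (_+_ to _⊕_)
  private
    module R¹ = LinearAlgebra (leftModule {R = R})
    module Rⁿ n = LinearAlgebra (R ^ᴹ n)

  linearCombination-lookup : ∀ {n} (x : Vector Carrier d) (b : Vector (Vector Carrier n) d) j →
    Rⁿ.linearCombination n x b j ≡ R¹.linearCombination x (λ i → b i j)
  linearCombination-lookup {zero}  x b j = ≡.refl
  linearCombination-lookup {suc d} x b j =
    ≡.cong (x zero * b zero j ⊕_) (linearCombination-lookup (x ∘ suc) (b ∘ suc) j)

-- Field extensions

module Extension (K : HeytingField c ℓ₁ ℓ₂) {q} (|K| : HasOrder K q)
                 (L : HeytingField c′ ℓ₁′ ℓ₂′) {m} (|L| : HasOrder L (q ^ m))
                 (ι : FieldEmbedding K L) where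
  L/K : LeftModule (ringOf K) c′ ℓ₁′
  L/K = restrictScalars {R = ringOf K} {S = ringOf L} ι

  private
    module K = HeytingField K
    module |L| = Inverse |L|
    module RL = CommutativeRing
      (HeytingCommutativeRing.commutativeRing (HeytingField.heytingCommutativeRing L))
    module L = FiniteField L |L|
  open HeytingField L hiding (zero) renaming (_+_ to _⊕_)
  open LeftModule L/K using (_*ₗ_; *ₗ-distribˡ)
  open LinearAlgebra L/K
  open LinearCombination L/K
  open FiniteModule K |K| L/K {m} |L|
  open CommutativeSemigroupProperties RL.+-commutativeSemigroup using (interchange)
  open CommutativeSemigroupProperties RL.*-commutativeSemigroup
    using (x∙yz≈y∙xz)

  -- The coefficients lie in `K` but `α` in `L`: evaluating a fixed `K`-relation is an `L`-linear
  -- map.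
  linearCombination-linearʳ : ∀ (x : Vector K.Carrier d) u α v →
    linearCombination x (λ i → u i ⊕ α * v i) ≈ linearCombination x u ⊕ α * linearCombination x v
  linearCombination-linearʳ {zero}  x u α v = sym (trans (+-congˡ (zeroʳ α)) (+-identityˡ 0#))
  linearCombination-linearʳ {suc d} x u α v = begin
    x zero *ₗ (u zero ⊕ α * v zero) ⊕ linearCombination (x ∘ suc) (λ i → u (suc i) ⊕ α * v (suc i))
      ≈⟨ +-cong (trans (*ₗ-distribˡ (x zero) _ _) (+-congˡ (x∙yz≈y∙xz _ _ _)))
                (linearCombination-linearʳ (x ∘ suc) (u ∘ suc) α (v ∘ suc)) ⟩
    (x zero *ₗ u zero ⊕ α * (x zero *ₗ v zero)) ⊕
      (linearCombination (x ∘ suc) (u ∘ suc) ⊕ α * linearCombination (x ∘ suc) (v ∘ suc))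
      ≈⟨ interchange _ _ _ _ ⟩
    linearCombination x u ⊕ (α * (x zero *ₗ v zero) ⊕ α * linearCombination (x ∘ suc) (v ∘ suc))
      ≈⟨ +-congˡ (distribˡ α _ _) ⟨
    linearCombination x u ⊕ α * linearCombination x v ∎
    where open SetoidReasoning RL.setoid

  -- If every member were dependent, choosing a relation for each α and the zero
  -- vector besides would give 1 + q ^ m pairwise distinct vectors of Kᵈ.
  pencil-independent : ∀ {d} → d ≤ m → (u v : Vector Carrier d) →
    (∀ x → linearCombination x u ≈ 0# → linearCombination x v ≈ 0# → ∀ i → x i K.≈ K.0#) →
    ∃[ α ] LinearlyIndependent (λ i → u i ⊕ α * v i)
  pencil-independent {d} d≤m u v common
    with decideFin (λ i → swap (dependent⊎independent (λ l → u l ⊕ |L|.from i * v l)))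
  ... | inj₁ (i , ind) = |L|.from i , ind
  ... | inj₂ dep = contradiction (pigeonhole (finiteVectors (ringOf K) |K| d) q^d<1+q^m relation)
          λ { (zero  , zero  , ()  , _)
            ; (suc _ , zero  , ()  , _)
            ; (zero  , suc j , _   , eq) → proj₂ (proj₂ (dep j)) (λ l → K.sym (eq l))
            ; (suc i , suc j , i<j , eq) → distinct i j eq (Fin.<⇒≢ i<j ∘ ≡.cong suc)
            }
    where
    open SetoidReasoning RL.setoid
    q^d<1+q^m : q ^ d < suc (q ^ m)
    q^d<1+q^m = s≤s (ℕ.^-monoʳ-≤ q {{>-nonZero (ℕ.<⇒≤ (FiniteField.1<order K |K|))}} d≤m)
    relation : Fin (suc (q ^ m)) → Vector K.Carrier d
    relation zero    = λ _ → K.0#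
    relation (suc i) = proj₁ (dep i)
    distinct : ∀ i j → (∀ l → relation (suc i) l K.≈ relation (suc j) l) → ¬ i ≢ j
    -- A shared relation gives `xu + αᵢ xv = 0 = xu + αⱼ xv`. If `xv` vanishes then so does `xu`,
    -- and `common` makes the relation zero; otherwise cancelling `xv` gives `αᵢ = αⱼ`.
    distinct i j eq i≢j with linearCombination (relation (suc i)) v L.≈? 0#
    ... | yes xv≈0 = proj₂ (proj₂ (dep i)) (common (relation (suc i)) xu≈0 xv≈0)
      where
      xu≈0 : linearCombination (relation (suc i)) u ≈ 0#
      xu≈0 = begin
        linearCombination (relation (suc i)) u
          ≈⟨ +-identityʳ _ ⟨
        linearCombination (relation (suc i)) u ⊕ 0#
          ≈⟨ +-congˡ (trans (*-congˡ xv≈0) (zeroʳ _)) ⟨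
        linearCombination (relation (suc i)) u ⊕ |L|.from i * linearCombination (relation (suc i)) v
          ≈⟨ linearCombination-linearʳ _ u _ v ⟨
        linearCombination (relation (suc i)) (λ l → u l ⊕ |L|.from i * v l)
          ≈⟨ proj₁ (proj₂ (dep i)) ⟩
        0# ∎
    ... | no xv≉0 with L.inverse xv≉0
    ...   | y , yxv≈1 = i≢j (from-injective |L| (begin
        |L|.from i                 ≈⟨ *-identityʳ _ ⟨
        |L|.from i * 1#            ≈⟨ *-congˡ (trans (*-comm _ _) yxv≈1) ⟨
        |L|.from i * (xv * y)      ≈⟨ *-assoc _ _ _ ⟨
        (|L|.from i * xv) * y      ≈⟨ *-congʳ αᵢxv≈αⱼxv ⟩
        (|L|.from j * xv) * y      ≈⟨ *-assoc _ _ _ ⟩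
        |L|.from j * (xv * y)      ≈⟨ *-congˡ (trans (*-comm _ _) yxv≈1) ⟩
        |L|.from j * 1#            ≈⟨ *-identityʳ _ ⟩
        |L|.from j                 ∎))
      where
      x  = relation (suc i)
      xu = linearCombination x u
      xv = linearCombination x v
      αᵢxv≈αⱼxv : |L|.from i * xv ≈ |L|.from j * xv
      αᵢxv≈αⱼxv = GroupProperties.∙-cancelˡ RL.+-group xu _ _ (begin
        xu ⊕ |L|.from i * xv                                        ≈⟨ linearCombination-linearʳ x u _ v ⟨
        linearCombination x (λ l → u l ⊕ |L|.from i * v l)          ≈⟨ proj₁ (proj₂ (dep i)) ⟩
        0#                                                          ≈⟨ proj₁ (proj₂ (dep j)) ⟨
        linearCombination (relation (suc j)) (λ l → u l ⊕ |L|.from j * v l)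
          ≈⟨ linearCombination-cong eq (λ _ → refl) ⟨
        linearCombination x (λ l → u l ⊕ |L|.from j * v l)          ≈⟨ linearCombination-linearʳ x u _ v ⟩
        xu ⊕ |L|.from j * xv                                        ∎)

  -- The rank support of `w` consists of the vectors `ψ (w i)` for `K`-linear `ψ : L → K`, where `ψ`
  -- has the values `s` on `γ`. As `u` is independent, some functional `G` sends each `u l` to
  -- `ψ (z l)`; applying it to `v = A u` gives `A (ψ z) = ψ w`. The values of `G` on `γ` are the new
  -- column coefficients.
  rankSupport-⊆ : (Γ : OrderedBasis K L ι m) → ∀ {n r} {v w : Vector Carrier n}
    {u : Vector Carrier r} → LinearlyIndependent u → r ≤ m →
    (A : Vector (Vector K.Carrier r) n) → (∀ j → v j ≈ linearCombination (A j) u) →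
    (z : Vector Carrier r) → (∀ j → w j ≈ linearCombination (A j) z) →
    rankSupport K L ι Γ w ⊆ rankSupport K L ι Γ v
  rankSupport-⊆ Γ {n} {r} {v} {w} {u} ind r≤m A v≈Au z w≈Az {t} (s , t≈) =
    G.φ ∘ γ , λ i → KR.trans (t≈ i) (reason i)
    where
    open OrderedBasis Γ
    open LinearAlgebra.IsBasisOf isBasis using (spanning)
    module KR = Ring (ringOf K)
    module K¹ where
      open LinearAlgebra (leftModule {R = ringOf K}) public
      open LinearCombination (leftModule {R = ringOf K}) public
    module Kⁿ = LinearAlgebra (ringOf K ^ᴹ n)
    module ψ = Functional (basisFunctional isBasis s)
    module G = Functional (independentFunctional ind r≤m (ψ.φ ∘ z))
    open SetoidReasoning KR.setoid

    coordinates : ∀ {n} → Vector Carrier n → Vector (Vector K.Carrier m) n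
    coordinates = coordinateMatrix K L ι Γ

    columnCombination : ∀ s v i →
      Kⁿ.linearCombination s (λ p i → coordinates v i p) i K.≈
      K¹.linearCombination (coordinates v i) s
    columnCombination s v i = KR.trans
      (KR.reflexive (linearCombination-lookup (ringOf K) s (λ p i → coordinates v i p) i))
      (CommutativeMonoidSum.sum-cong-≋ KR.+-commutativeMonoid
        (λ p → K.*-comm (s p) (coordinates v i p)))

    reason : ∀ i → Kⁿ.linearCombination s (λ p i → coordinates w i p) i K.≈
                   Kⁿ.linearCombination (G.φ ∘ γ) (λ p i → coordinates v i p) i
    reason i = begin
      Kⁿ.linearCombination s (λ p i → coordinates w i p) i         ≈⟨ columnCombination s w i ⟩
      ψ.φ (w i)                                                    ≈⟨ ψ.linear (A i) z (w≈Az i) ⟩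
      K¹.linearCombination (A i) (ψ.φ ∘ z)                         ≈⟨ G.values (A i) (v≈Au i) ⟨
      G.φ (v i)                                                    ≈⟨ G.linear (coordinates v i) γ (proj₂ (spanning {v i} tt)) ⟩
      K¹.linearCombination (coordinates v i) (G.φ ∘ γ)             ≈⟨ columnCombination (G.φ ∘ γ) v i ⟨
      Kⁿ.linearCombination (G.φ ∘ γ) (λ p i → coordinates v i p) i ∎

-- Minimal codes

module MinimalCode (K : HeytingField c ℓ₁ ℓ₂) {q} (|K| : HasOrder K q)
                   (L : HeytingField c′ ℓ₁′ ℓ₂′) {m} (|L| : HasOrder L (q ^ m))
                   (ι : FieldEmbedding K L) (Γ : OrderedBasis K L ι m)
                   -- The dimension is at least 2 by its form, and a hyperplane of the code has
                   -- dimension `suc k`.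
                   {n k} (C : Code L n (suc (suc k)) p) (minimal : IsMinimal K L ι Γ C) where
  private
    module K = HeytingField K
    module LF = FiniteField L |L|
    module |Lᵏ| = Inverse (finiteVectors (ringOf L) |L| (suc (suc k)))
    module RL = CommutativeRing
      (HeytingCommutativeRing.commutativeRing (HeytingField.heytingCommutativeRing L))
    module Lⁿ where
      open LeftModule (ringOf L ^ᴹ n) public
      open LinearAlgebra (ringOf L ^ᴹ n) public
      open LinearCombination (ringOf L ^ᴹ n) public
  open HeytingField L hiding (zero) renaming (_+_ to _⊕_)
  open Extension K |K| L {m} |L| ι
  open LinearAlgebra L/K
  open LinearCombination L/K
  open FiniteModule K |K| L/K {m} |L|
  open LeftModule L/K using (_*ₗ_; *ₗ-cong)
  open Code C
  open Lⁿ.IsSubmodule isSubspace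
  open CommutativeSemigroupProperties RL.+-commutativeSemigroup using (interchange)
  open SetoidReasoning RL.setoid

  generator : Vector (Vector Carrier n) (suc (suc k))
  generator = proj₁ hasDimension

  open Lⁿ.IsBasisOf (proj₂ hasDimension)
    using (members) renaming (independent to generator-independent)

  -- Codewords are represented by their coefficients, so that searching and counting them takes
  -- place among finitely many vectors over `L`.
  word : Vector Carrier (suc (suc k)) → Vector Carrier n
  word x = Lⁿ.linearCombination x generator

  word∈C : ∀ x → word x ∈ Codeword
  word∈C x = closed x generator members
    where
    closed : ∀ {d} (x : Vector Carrier d) b → (∀ i → b i ∈ Codeword) →
             Lⁿ.linearCombination x b ∈ Codeword
    closed {zero}  x b mem = 0ᴹ-closed
    closed {suc d} x b mem = +ᴹ-closed (*ₗ-closed (x zero) (mem zero))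
                                 (closed (x ∘ suc) (b ∘ suc) (mem ∘ suc))

  word-cong : ∀ {x y} → (∀ i → x i ≈ y i) → ∀ j → word x j ≈ word y j
  word-cong x≈y = Lⁿ.linearCombination-cong {u = generator} x≈y (λ _ _ → refl)

  -- If entry `j` of `word x` depends on those at `I` through `a`, all codewords are searched for
  -- one violating this relation. Such a word spans with `word x` a pencil to which
  -- `pencil-independent` applies.
  extend⊎relation : ∀ {r} → r < m → ∀ x (I : Vector (Fin n) r) →
    LinearlyIndependent (word x ∘ I) → ∀ j →
    (∃[ y ] LinearlyIndependent (word y ∘ (j ∷ I))) ⊎
    (Σ[ a ∈ Vector K.Carrier r ] (∀ y → word y j ≈ linearCombination a (word y ∘ I)))
  extend⊎relation {r} r<m x I ind j with dependent⊎independent (word x ∘ (j ∷ I))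
  ... | inj₂ ind′ = inj₁ (x , ind′)
  ... | inj₁ dep with dependent⇒span (word x ∘ (j ∷ I)) ind dep
  ...   | a , x-rel with decideFin decide
    where
    decide : ∀ i → let y = |Lᵏ|.from i in
      ¬ word y j ≈ linearCombination a (word y ∘ I) ⊎ word y j ≈ linearCombination a (word y ∘ I)
    decide i = swap (toSum (word (|Lᵏ|.from i) j LF.≈?
                            linearCombination a (word (|Lᵏ|.from i) ∘ I)))
  ...     | inj₂ rel = inj₂ (a , λ y →
              let y≈ = word-cong (from∘to (finiteVectors (ringOf L) |L| (suc (suc k))) y) in
              trans (sym (y≈ j)) (trans (rel (|Lᵏ|.to y))
                (linearCombination-cong (λ _ → K.refl) (y≈ ∘ I))))
  ...     | inj₁ (i , ¬y-rel)
    with pencil-independent r<m (word x ∘ (j ∷ I)) (word (|Lᵏ|.from i) ∘ (j ∷ I)) common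
    where
    y = |Lᵏ|.from i
    substitute : ∀ c w → linearCombination (λ l → c (suc l) K.+ c zero K.* a l) (w ∘ I) ≈
                         linearCombination (c ∘ suc) (w ∘ I) ⊕ c zero *ₗ linearCombination a (w ∘ I)
    substitute c w = linearCombination-linearˡ (c ∘ suc) (c zero) a (w ∘ I)
    -- Write `c = (c₀ , c′)`. For `x`, substituting `x-rel` leaves the relation `c′ + c₀ a` among
    -- independent entries, so `c′ = - c₀ a`. For `y` this leaves `c₀` times the relation that `y`
    -- violates, hence `c₀ = 0` and then `c′ = 0`.
    common : ∀ c → linearCombination c (word x ∘ (j ∷ I)) ≈ 0# →
             linearCombination c (word y ∘ (j ∷ I)) ≈ 0# → ∀ l → c l K.≈ K.0#
    common c cx≈0 cy≈0 = λ { zero → c₀≈0 ; (suc l) → K.trans (K.sym (K.trans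
        (K.+-congˡ (K.trans (K.*-congʳ c₀≈0) (K.zeroˡ (a l)))) (K.+-identityʳ _))) (c′+c₀a≈0 l) }
      where
      c′+c₀a≈0 : ∀ l → c (suc l) K.+ c zero K.* a l K.≈ K.0#
      c′+c₀a≈0 = ind _ (begin
        linearCombination (λ l → c (suc l) K.+ c zero K.* a l) (word x ∘ I)
          ≈⟨ substitute c (word x) ⟩
        linearCombination (c ∘ suc) (word x ∘ I) ⊕ c zero *ₗ linearCombination a (word x ∘ I)
          ≈⟨ +-congˡ (*ₗ-cong K.refl x-rel) ⟨
        linearCombination (c ∘ suc) (word x ∘ I) ⊕ c zero *ₗ word x j
          ≈⟨ +-comm _ _ ⟩
        linearCombination c (word x ∘ (j ∷ I))
          ≈⟨ cx≈0 ⟩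
        0# ∎)
      c₀≈0 : c zero K.≈ K.0#
      c₀≈0 with FiniteField._≈?_ K |K| (c zero) K.0#
      ... | yes eq = eq
      ... | no neq = contradiction (*ₗ-cancelˡ neq (GroupProperties.∙-cancelˡ RL.+-group _ _ _ (begin
        linearCombination (c ∘ suc) (word y ∘ I) ⊕ c zero *ₗ word y j
          ≈⟨ +-comm _ _ ⟩
        linearCombination c (word y ∘ (j ∷ I))
          ≈⟨ cy≈0 ⟩
        0#
          ≈⟨ linearCombination-zero (word y ∘ I) ⟨
        linearCombination (λ _ → K.0#) (word y ∘ I)
          ≈⟨ linearCombination-cong c′+c₀a≈0 (λ _ → refl) ⟨
        linearCombination (λ l → c (suc l) K.+ c zero K.* a l) (word y ∘ I)
          ≈⟨ substitute c (word y) ⟩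
        linearCombination (c ∘ suc) (word y ∘ I) ⊕ c zero *ₗ linearCombination a (word y ∘ I) ∎))) ¬y-rel
  ...       | α , ind′ = inj₁ ((λ l → x l ⊕ α * |Lᵏ|.from i l) , independent-cong
                (λ l → sym (Lⁿ.linearCombination-linearˡ x α (|Lᵏ|.from i) generator ((j ∷ I) l))) ind′)

  -- The two cases of `maximal` are the two ways in which the growth can stop; in the second, the
  -- matrix `A` found for `word x` serves the whole code.
  record MaximalRankWord : Set (c ⊔ ℓ₁ ⊔ c′ ⊔ ℓ₁′) where
    field
      x       : Vector Carrier (suc (suc k))
      rank    : ℕ
      rank≤m  : rank ≤ m
      I       : Vector (Fin n) rank
      ind     : LinearlyIndependent (word x ∘ I)
      A       : Vector (Vector K.Carrier rank) n
      x-rel   : ∀ j → word x j ≈ linearCombination (A j) (word x ∘ I)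
      maximal : rank ≡ m ⊎ (∀ y j → word y j ≈ linearCombination (A j) (word y ∘ I))

  maximalRankWord : MaximalRankWord
  maximalRankWord = grow m (ℕ.+-identityʳ m) (λ _ → 0#) (λ ()) (λ _ _ ())
    where
    -- `e` counts the entries still missing from `m`, and the recursion descends on it.
    grow : ∀ e {r} → e + r ≡ m → ∀ x (I : Vector (Fin n) r) →
           LinearlyIndependent (word x ∘ I) → MaximalRankWord
    grow zero ≡.refl x I ind = record
      { x = x ; I = I ; rank≤m = ℕ.≤-refl ; ind = ind
      ; A       = λ j → proj₁ (independent⇒span (word x ∘ I) ind ℕ.≤-refl (word x j))
      ; x-rel   = λ j → proj₂ (independent⇒span (word x ∘ I) ind ℕ.≤-refl (word x j))
      ; maximal = inj₁ ≡.refl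
      }
    grow (suc e) {r} e+r≡m x I ind with decideFin (extend⊎relation r<m x I ind)
      where
      r<m : r < m
      r<m = ℕ.≤-trans (s≤s (ℕ.m≤n+m r e)) (ℕ.≤-reflexive e+r≡m)
    ... | inj₁ (j , y , ind′) = grow e (≡.trans (ℕ.+-suc e r) e+r≡m) y (j ∷ I) ind′
    ... | inj₂ rel = record
      { x = x ; I = I ; ind = ind
      ; rank≤m  = ℕ.≤-trans (ℕ.m≤n+m r (suc e)) (ℕ.≤-reflexive e+r≡m)
      ; A       = proj₁ ∘ rel
      ; x-rel   = λ j → proj₂ (rel j) x
      ; maximal = inj₂ λ y j → proj₂ (rel j) y
      }

  -- A hyperplane containing no nonzero word of the form `A z`

  open MaximalRankWord maximalRankWord

  -- i₀ is a nonzero coordinate of x if there is one; if x = 0, any index will do.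
  multiples-vanish : ∃[ i₀ ] (∀ (y : Vector Carrier (suc (suc k))) α →
    y i₀ ≈ 0# → (∀ i → y i ≈ α * x i) → ∀ i → y i ≈ 0#)
  multiples-vanish with decideFin (λ i → swap (toSum (x i LF.≈? 0#)))
  ... | inj₂ x≈0 = zero , λ y α _ y≈αx i → trans (y≈αx i) (trans (*-congˡ (x≈0 i)) (zeroʳ α))
  ... | inj₁ (i₀ , xᵢ≉0) with LF.inverse xᵢ≉0
  ...   | t , txᵢ≈1 = i₀ , λ y α yᵢ≈0 y≈αx i →
          trans (y≈αx i) (trans (*-congʳ (begin
            α               ≈⟨ *-identityʳ α ⟨
            α * 1#          ≈⟨ *-congˡ (trans (*-comm _ _) txᵢ≈1) ⟨
            α * (x i₀ * t)  ≈⟨ *-assoc _ _ _ ⟨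
            α * x i₀ * t    ≈⟨ *-congʳ (trans (sym (y≈αx i₀)) yᵢ≈0) ⟩
            0# * t          ≈⟨ zeroˡ t ⟩
            0#              ∎)) (zeroˡ (x i)))

  i₀ : Fin (suc (suc k))
  i₀ = proj₁ multiples-vanish

  -- A word `A z` has its rank support inside that of `word x`, so minimality makes it a multiple of
  -- `word x`. Independence of the generators turns this into `y = α x`, and the hyperplane
  -- condition `y i₀ = 0` finishes.
  vanish : ∀ y z → (∀ j → word y j ≈ linearCombination (A j) z) → y i₀ ≈ 0# → ∀ i → y i ≈ 0#
  vanish y z y≈Az yᵢ≈0
    with minimal (word∈C x) (word∈C y) (rankSupport-⊆ Γ ind rank≤m A x-rel z y≈Az)
  ... | α , wy≈αwx = proj₂ multiples-vanish y α yᵢ≈0 λ i → trans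
    (Lⁿ.independent⇒injective {b = generator} generator-independent
      y (λ i → 0# ⊕ α * x i) (λ j → begin
      word y j                                   ≈⟨ wy≈αwx j ⟩
      α * word x j                               ≈⟨ +-identityˡ _ ⟨
      0# ⊕ α * word x j                          ≈⟨ +-congʳ (Lⁿ.linearCombination-zero generator j) ⟨
      word (λ _ → 0#) j ⊕ α * word x j           ≈⟨ Lⁿ.linearCombination-linearˡ (λ _ → 0#) α x generator j ⟨
      word (λ i → 0# ⊕ α * x i) j                ∎) i)
    (+-identityˡ _)

  -- In the other case every codeword is of the form `A z`, so `vanish` would kill the vector with 0
  -- at `i₀` and 1 elsewhere. Dimension at least 2 supplies the index `punchIn i₀ zero`, where its
  -- value is 1.
  rank≡m : rank ≡ m
  rank≡m with maximal
  ... | inj₁ eq  = eq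
  ... | inj₂ rel = contradiction
          (trans (reflexive (≡.sym (insertAt-punchIn (λ _ → 1#) i₀ 0# zero)))
                 (vanish y (word y ∘ I) (rel y) (reflexive (insertAt-lookup (λ _ → 1#) i₀ 0#))
                         (punchIn i₀ zero)))
          LF.1≉0
    where
    y = insertAt (λ _ → 1#) i₀ 0#

  -- Uniqueness of coefficients makes the rows of `A` at the chosen indices those of the identity
  -- matrix, so `z` can be read off from `A z` for every `z` over `L`.
  A-pivot : ∀ z l → linearCombination (A (I l)) z ≈ z l
  A-pivot z l = trans
    (linearCombination-cong (independent⇒injective {b = word x ∘ I} ind (A (I l)) (unitVector l)
      (trans (sym (x-rel (I l))) (sym (linearCombination-unit l (word x ∘ I))))) (λ _ → refl))
    (linearCombination-unit l z)

  length-bound : suc k + m ≤ n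
  length-bound = ℕ.≮⇒≥ λ n<k+m → contradiction
    (≡.subst (λ r → n < suc k + r) (≡.sym rank≡m) n<k+m)
    n≮k+rank
    where
    module |U| = Inverse (finiteVectors (ringOf L) |L| (suc k + rank))
    left : Vector Carrier (suc k + rank) → Vector Carrier (suc (suc k))
    -- The first `suc k` entries of `u` parametrise the hyperplane `y i₀ = 0`; the remaining `rank`
    -- entries are `z`.
    left u = insertAt (u ∘ (_↑ˡ rank)) i₀ 0#
    left-i₀ : ∀ u → left u i₀ ≈ 0#
    left-i₀ u = reflexive (insertAt-lookup (u ∘ (_↑ˡ rank)) i₀ 0#)
    left-punchIn : ∀ u i → left u (punchIn i₀ i) ≈ u (i ↑ˡ rank)
    left-punchIn u i = reflexive (insertAt-punchIn (u ∘ (_↑ˡ rank)) i₀ 0# i)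
    right : Vector Carrier (suc k + rank) → Vector Carrier rank
    right u = u ∘ (suc k ↑ʳ_)
    Φ : Vector Carrier (suc k + rank) → Vector Carrier n
    Φ u j = word (left u) j ⊕ linearCombination (A j) (right u)
    rearrange : ∀ {a b c d} → a ⊕ b ≈ c ⊕ d → a ⊕ (- 1#) * c ≈ d ⊕ (- 1#) * b
    rearrange {a} {b} {c} {d} eq = trans (+-congˡ (RingProperties.-1*x≈-x RL.ring c))
      (trans (GroupProperties.∙-cancelʳ RL.+-group (c ⊕ b) _ _ (begin
        (a ⊕ - c) ⊕ (c ⊕ b)   ≈⟨ +-congˡ (+-comm c b) ⟩
        (a ⊕ - c) ⊕ (b ⊕ c)   ≈⟨ interchange a (- c) b c ⟩
        (a ⊕ b) ⊕ (- c ⊕ c)   ≈⟨ +-cong eq (trans (-‿inverseˡ c) (sym (-‿inverseˡ b))) ⟩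
        (c ⊕ d) ⊕ (- b ⊕ b)   ≈⟨ +-congʳ (+-comm c d) ⟩
        (d ⊕ c) ⊕ (- b ⊕ b)   ≈⟨ interchange d (- b) c b ⟨
        (d ⊕ - b) ⊕ (c ⊕ b)   ∎))
      (+-congˡ (sym (RingProperties.-1*x≈-x RL.ring b))))
    Φ-injective : ∀ u v → (∀ j → Φ u j ≈ Φ v j) → ∀ i → u i ≈ v i
    Φ-injective u v Φu≈Φv i =
      ≡.subst (λ i → u i ≈ v i) (Fin.join-splitAt (suc k) rank i) (cases (splitAt (suc k) i))
      where
      -- Equal images put the difference of the two hyperplane words in the form
      -- `A (right v - right u)`, so `vanish` applies to it.
      left≈ : ∀ i → left u i ≈ left v i
      left≈ i = GroupProperties.x∙y⁻¹≈ε⇒x≈y RL.+-group _ _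
        (trans (+-congˡ (sym (RingProperties.-1*x≈-x RL.ring _)))
          (vanish (λ i → left u i ⊕ (- 1#) * left v i) (λ l → right v l ⊕ (- 1#) * right u l)
            (λ j → begin
              word (λ i → left u i ⊕ (- 1#) * left v i) j
                ≈⟨ Lⁿ.linearCombination-linearˡ (left u) (- 1#) (left v) generator j ⟩
              word (left u) j ⊕ (- 1#) * word (left v) j
                ≈⟨ rearrange (Φu≈Φv j) ⟩
              linearCombination (A j) (right v) ⊕ (- 1#) * linearCombination (A j) (right u)
                ≈⟨ linearCombination-linearʳ (A j) (right v) (- 1#) (right u) ⟨
              linearCombination (A j) (λ l → right v l ⊕ (- 1#) * right u l) ∎)
            (trans (+-cong (left-i₀ u)
                           (trans (*-congˡ (left-i₀ v)) (zeroʳ _)))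
                   (+-identityʳ 0#))
            i))
      cases : ∀ s → u (join (suc k) rank s) ≈ v (join (suc k) rank s)
      cases (inj₁ i) = trans (sym (left-punchIn u i)) (trans (left≈ (punchIn i₀ i)) (left-punchIn v i))
      -- With the hyperplane words equal, cancelling them at the chosen index `I l` leaves exactly
      -- the entry `l` of `right`.
      cases (inj₂ l) = trans (sym (A-pivot (right u) l)) (trans
        (GroupProperties.∙-cancelˡ RL.+-group _ _ _
          (trans (Φu≈Φv (I l)) (+-congʳ (sym (word-cong left≈ (I l))))))
        (A-pivot (right v) l))
    n≮k+rank : ¬ n < suc k + rank
    n≮k+rank n<k+rank
      with pigeonhole (finiteVectors (ringOf L) |L| n) (ℕ.^-monoʳ-< (q ^ m) LF.1<order n<k+rank) (Φ ∘ |U|.from)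
    ... | i , j , i<j , eq = Fin.<⇒≢ i<j
      (from-injective (finiteVectors (ringOf L) |L| (suc k + rank))
        (Φ-injective (|U|.from i) (|U|.from j) eq))

corollary5p10 : {c ℓ₁ ℓ₂ c′ ℓ₁′ ℓ₂′ p : Level}
    (q n m k : ℕ) → IsPrimePower q →
    .{{_ : NonZero n}} .{{_ : NonZero m}} .{{_ : NonZero k}} →
    (K : HeytingField c ℓ₁ ℓ₂) → HasOrder K q →
    (L : HeytingField c′ ℓ₁′ ℓ₂′) → HasOrder L (q ^ m) →
    (ι : FieldEmbedding K L) (Γ : OrderedBasis K L ι m) →
    (C : Code L n k p) → IsMinimal K L ι Γ C →
    k ≥ 2 → n ≥ k + m ∸ 1
-- For this form of the dimension, `k + m ∸ 1` reduces to the bound `suc k + m` of `length-bound`.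
corollary5p10 q n m (suc (suc k)) _ K |K| L |L| ι Γ C minimal (s≤s (s≤s z≤n)) =
  MinimalCode.length-bound K |K| L {m} |L| ι Γ C minimal
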